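{- For any connected block graph $G$ and any vertex $x \in V(G)$, \[ p_x(G) = \begin{cases} \mathrm{s}(G) - 1, & \text{if } x \text{ is a simplicial vertex,} \\ \mathrm{s}(G), & \text{otherwise,} \end{cases} \] where $\mathrm{s}(G)$ is the number of simplicial vertices of $G$.
   Context: All graphs are finite, undirected and simple. A graph is a block graph if every maximal $2$-connected component is a clique. A vertex $v$ is simplicial if the subgraph induced by its neighbourhood $N(v)$ is complete. A $u,v$-geodesic is a shortest $u,v$-path. For a vertex $x$ of $G$, a set $S \subseteq V(G)$ is an $x$-position set if for every $y \in S$ no vertex of $S \setminus \{y\}$ lies on any $x,y$-geodesic in $G$. The $x$-position number $p_x(G)$ is the maximum cardinality of an $x$-position set of $G$.
   Formalization: The graph is assumed to have at least two vertices: for the one-vertex graph the formula gives s(G) − 1 = 0, while {x} is an x-position set, so p_x(G) = 1. -}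

module Defs where

open import Data.Nat.Base using (ℕ; suc; _≤_)
open import Data.Fin.Base using (Fin)
open import Data.Fin.Properties using (_≟_; all?)
open import Data.Fin.Subset using (Subset; _∈_; _⊆_; _-_; ∣_∣)
open import Data.List.Base using (List; []; _∷_; length; filter; allFin)
import Data.List.Membership.Propositional as List
open import Data.List.Relation.Unary.All using (All)
open import Data.List.Relation.Unary.Unique.Propositional using (Unique)
open import Data.Product.Base using (Σ-syntax; ∃-syntax; _×_; proj₁)
open import Level using (0ℓ)
open import Relation.Binary.Construct.Closure.ReflexiveTransitive using (Star; ε; _◅_)
open import Relation.Binary.Core using (Rel)
open import Relation.Binary.Definitions using (Decidable; Symmetric)
open import Relation.Binary.PropositionalEquality using (_≡_; _≢_)
open import Relation.Nullary using (¬_; Dec; ¬?; _→-dec_)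
open import Relation.Unary using (Pred)

record Graph (n : ℕ) : Set₁ where
  field
    Adj    : Rel (Fin n) 0ℓ
    adj?   : Decidable Adj
    sym    : Symmetric Adj
    irrefl : ∀ {v} → ¬ Adj v v

module _ {n : ℕ} (G : Graph n) where
  open Graph G

  Walk : Rel (Fin n) 0ℓ
  Walk = Star Adj

  vertices : ∀ {u v} → Walk u v → List (Fin n)
  vertices {u} ε       = u ∷ []
  vertices {u} (_ ◅ w) = u ∷ vertices w

  edges : ∀ {u v} → Walk u v → ℕ
  edges ε       = 0
  edges (_ ◅ w) = suc (edges w)

  Path : Rel (Fin n) 0ℓ
  Path u v = Σ[ w ∈ Walk u v ] Unique (vertices w)

  IsGeodesic : ∀ {u v} → Path u v → Set
  IsGeodesic {u} {v} P = (Q : Path u v) → edges (proj₁ P) ≤ edges (proj₁ Q)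

  LiesOn : ∀ {u v} → Fin n → Path u v → Set
  LiesOn z P = z List.∈ vertices (proj₁ P)

  Connected : Set
  Connected = ∀ u v → Walk u v

  -- Connectedness of the subgraph induced by B.
  ConnectedOn : Subset n → Set
  ConnectedOn B = ∀ {u v} → u ∈ B → v ∈ B → Σ[ w ∈ Walk u v ] All (_∈ B) (vertices w)

  -- 2-connected subgraphs are represented by their vertex sets: adding edges
  -- preserves 2-connectedness, so the maximal ones are induced subgraphs.
  TwoConnected : Subset n → Set
  TwoConnected B = 3 ≤ ∣ B ∣ × ConnectedOn B × (∀ {v} → v ∈ B → ConnectedOn (B - v))

  MaximalTwoConnected : Subset n → Set
  MaximalTwoConnected B = TwoConnected B × (∀ {C} → TwoConnected C → B ⊆ C → C ⊆ B)

  IsClique : Pred (Fin n) 0ℓ → Set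
  IsClique P = ∀ u v → P u → P v → u ≢ v → Adj u v

  -- Blocks with at most two vertices (cut edges, isolated vertices) are not
  -- 2-connected in the above sense, but they are cliques in any case.
  IsBlockGraph : Set
  IsBlockGraph = ∀ {B} → MaximalTwoConnected B → IsClique (_∈ B)

  -- Adj v, as a predicate, is the neighbourhood N(v).
  Simplicial : Pred (Fin n) 0ℓ
  Simplicial v = IsClique (Adj v)

  simplicial? : ∀ v → Dec (Simplicial v)
  simplicial? v = all? λ a → all? λ b →
    adj? v a →-dec (adj? v b →-dec (¬? (a ≟ b) →-dec adj? a b))

  s : ℕ
  s = length (filter simplicial? (allFin n))

  -- S may contain x itself; since x lies on every x,y-geodesic, in a connected
  -- graph this forces S = {x}.  In particular pₓ(K₁) = 1, although s(K₁) - 1 = 0.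
  IsPositionSet : Fin n → Subset n → Set
  IsPositionSet x S = ∀ {y z} → y ∈ S → z ∈ S → z ≢ y →
    (P : Path x y) → IsGeodesic P → ¬ LiesOn z P

  -- k is the maximum cardinality of an x-position set, i.e. k = pₓ(G).
  IsPositionNumber : Fin n → ℕ → Set
  IsPositionNumber x k =
    (∃[ S ] IsPositionSet x S × ∣ S ∣ ≡ k) × (∀ {S} → IsPositionSet x S → ∣ S ∣ ≤ k)

{-# OPTIONS --safe #-}
module Submission where

-- Say that y dominates w if every walk from x to w meets y.  The neighbours of
-- a vertex y that are joined by a walk avoiding y lie with y on a cycle, hence in a
-- common block, so in a block graph they are adjacent.  A vertex y ≠ x that
-- dominates no other vertex is therefore simplicial: all its neighbours are joined
-- to x, and so to each other, avoiding y.  Climbing along domination, which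
-- increases the distance from x, every vertex dominates a simplicial vertex other
-- than x.  The vertices of an x-position set do not dominate each other, whereas two
-- dominators of one vertex are comparable, so this assigns distinct simplicial
-- vertices to them.  Conversely, a walk can be shortened at a simplicial inner
-- vertex, so the simplicial vertices other than x form an x-position set.
--
-- Existence statements about walks are used under double negation, which is
-- harmless as the conclusions (≤, ∈, Adj) are decidable.

open import Defs
open import Data.Nat.Base using (ℕ; zero; suc; _+_; _∸_; _≤_; _<_; z≤n; s≤s)
import Data.Nat.Properties as ℕ
open import Data.Nat.Induction using (<-rec)
open import Data.Fin.Base using (Fin; zero; suc)
open import Data.Fin.Properties using (_≟_; 0≢1+n)
open import Data.Fin.Subset using (Subset; inside; outside; _∈_; _∉_; _⊆_; _⊃_; _-_; ∣_∣; ⊤)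
open import Data.Fin.Subset.Induction using (⊃-wellFounded)
open import Data.Fin.Subset.Properties
  using (_∈?_; ∈⊤; ∣p∣≤n; ∣p─q∣≤∣p∣; p─q⊆p; p─⊥≡p; x∈p∧x≢y⇒x∈p-y; x∈p⇒∣p-x∣<∣p∣)
open import Data.List.Base using (List; []; _∷_; length; filter)
import Data.List.Base as List
import Data.List.Membership.Propositional as List
import Data.List.Membership.DecPropositional as DecMembership
open import Data.List.Relation.Unary.All using (All; []; _∷_)
import Data.List.Relation.Unary.All as All
open import Data.List.Relation.Unary.All.Properties using (¬Any⇒All¬)
open import Data.List.Relation.Unary.Any using (here; there)
open import Data.List.Relation.Unary.AllPairs using ([]; _∷_)
open import Data.List.Relation.Unary.Unique.Propositional using (Unique)
open import Data.Product.Base using (Σ-syntax; ∃-syntax; _×_; _,_; proj₁)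
open import Data.Sum.Base using (_⊎_; inj₁; inj₂)
open import Data.Vec.Base using ([]; _∷_; here; there; tabulate)
open import Data.Vec.Properties using ([]=⇒lookup; lookup⇒[]=; lookup∘tabulate)
open import Data.Bool.Base using (true)
open import Function.Base using (_∘_; id)
open import Induction.WellFounded using (Acc; acc)
open import Level using (0ℓ)
open import Relation.Binary.Construct.Closure.ReflexiveTransitive using (ε; _◅_)
open import Relation.Binary.PropositionalEquality
  using (_≡_; _≢_; refl; sym; trans; cong; subst; ≢-sym)
open import Relation.Nullary using (¬_; Dec; yes; no; contradiction)
open import Relation.Nullary.Decidable using (does; decidable-stable; dec-true)
open import Relation.Unary using (Pred; Decidable)

private
  variable
    m n : ℕ

-- Finite subsets

toSubset : {P : Pred (Fin n) 0ℓ} → Decidable P → Subset n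
toSubset P? = tabulate (does ∘ P?)

∈-toSubset⁺ : {P : Pred (Fin n) 0ℓ} (P? : Decidable P) → ∀ {i} → P i → i ∈ toSubset P?
∈-toSubset⁺ P? {i} p =
  lookup⇒[]= i _ (trans (lookup∘tabulate (does ∘ P?) i) (dec-true (P? i) p))

∈-toSubset⁻ : {P : Pred (Fin n) 0ℓ} (P? : Decidable P) → ∀ {i} → i ∈ toSubset P? → P i
∈-toSubset⁻ {P = P} P? {i} i∈ = from (P? i)
  (trans (sym (lookup∘tabulate (does ∘ P?) i)) ([]=⇒lookup i∈))
  where
  from : (d : Dec (P i)) → does d ≡ true → P i
  from (yes p) refl = p

∣toSubset∣ : {A : Set} {P : Pred A 0ℓ} (P? : Decidable P) (f : Fin n → A) →
  ∣ toSubset (P? ∘ f) ∣ ≡ length (filter P? (List.tabulate f))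
∣toSubset∣ {zero}  P? f = refl
∣toSubset∣ {suc n} P? f with P? (f zero)
... | yes _ = cong suc (∣toSubset∣ P? (f ∘ suc))
... | no  _ = ∣toSubset∣ P? (f ∘ suc)

x∉p-x : (p : Subset n) (x : Fin n) → x ∉ p - x
x∉p-x (outside ∷ p) zero    ()
x∉p-x (inside  ∷ p) zero    ()
x∉p-x (_ ∷ p) (suc x) (there x∈) = x∉p-x p x x∈

x∈p⇒∣p-x∣≡∣p∣∸1 : {p : Subset n} {x : Fin n} → x ∈ p → ∣ p - x ∣ ≡ ∣ p ∣ ∸ 1
x∈p⇒∣p-x∣≡∣p∣∸1 {p = inside  ∷ p} here = cong ∣_∣ (p─⊥≡p p)
x∈p⇒∣p-x∣≡∣p∣∸1 {p = outside ∷ p} (there x∈) = x∈p⇒∣p-x∣≡∣p∣∸1 x∈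
-- The tail contains `x`, so its size is positive and the `suc` undoes the truncated subtraction.
x∈p⇒∣p-x∣≡∣p∣∸1 {p = inside  ∷ p} {x = suc x} (there x∈) =
  trans (cong suc (x∈p⇒∣p-x∣≡∣p∣∸1 x∈)) (ℕ.m+[n∸m]≡n (ℕ.≤-trans (s≤s z≤n) (x∈p⇒∣p-x∣<∣p∣ x∈)))

length-unique≤ : {xs : List (Fin n)} (p : Subset n) → Unique xs → All (_∈ p) xs → length xs ≤ ∣ p ∣
length-unique≤ p [] [] = z≤n
length-unique≤ p (x∉xs ∷ u) (x∈p ∷ xs⊆p) = ℕ.<-≤-trans
  (s≤s (length-unique≤ (p - _) u
    (All.zipWith (λ (x≢y , y∈p) → x∈p∧x≢y⇒x∈p-y y∈p (≢-sym x≢y)) (x∉xs , xs⊆p))))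
  (x∈p⇒∣p-x∣<∣p∣ x∈p)

-- Pigeonhole for a relation instead of a function, because the partner in `q` is known to exist
-- only under double negation. Each element of `p` uses up one partner, which is removed from `q`.
∣∣-mono-injective : (p : Subset m) (q : Subset n) (R : Fin m → Fin n → Set) →
  (∀ {i} → i ∈ p → ¬ ¬ (∃[ j ] j ∈ q × R i j)) →
  (∀ {i i′ j} → i ∈ p → i′ ∈ p → R i j → R i′ j → i ≡ i′) →
  ∣ p ∣ ≤ ∣ q ∣
∣∣-mono-injective [] q R total inj = z≤n
∣∣-mono-injective (outside ∷ p) q R total inj =
  ∣∣-mono-injective p q (R ∘ suc) (λ i∈ → total (there i∈)) inj′
  where
  inj′ : ∀ {i i′ j} → i ∈ p → i′ ∈ p → R (suc i) j → R (suc i′) j → i ≡ i′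
  inj′ i∈ i′∈ r r′ with refl ← inj (there i∈) (there i′∈) r r′ = refl
∣∣-mono-injective (inside ∷ p) q R total inj =
  decidable-stable (_ ℕ.≤? _) λ ¬≤ → total here λ (j₀ , j₀∈ , r₀) → ¬≤ (ℕ.<-≤-trans
    (s≤s (∣∣-mono-injective p (q - j₀) (R ∘ suc)
      (λ i∈ ¬∃ → total (there i∈) λ (j , j∈ , r) →
        -- A later index with partner `j₀` would equal `zero` by injectivity, so `j` survives the
        -- removal.
        ¬∃ (j , x∈p∧x≢y⇒x∈p-y j∈ (λ { refl → 0≢1+n (inj here (there i∈) r₀ r) }) , r))
      inj′))
    (x∈p⇒∣p-x∣<∣p∣ j₀∈))
  where
  inj′ : ∀ {i i′ j} → i ∈ p → i′ ∈ p → R (suc i) j → R (suc i′) j → i ≡ i′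
  inj′ i∈ i′∈ r r′ with refl ← inj (there i∈) (there i′∈) r r′ = refl

other-vertex : 2 ≤ n → (x : Fin n) → ∃[ w ] x ≢ w
other-vertex (s≤s (s≤s _)) zero    = suc zero , λ ()
other-vertex (s≤s (s≤s _)) (suc x) = zero , λ ()

module _ {n : ℕ} (G : Graph n) where
  open Graph G renaming (sym to Adj-sym)
  open DecMembership (_≟_ {n}) using () renaming (_∈?_ to _∈ᴸ?_)

  -- Walks

  -- With `P = y ≢_` this is a walk avoiding `y`; with `P = _∈ B`, a walk in the subgraph induced by
  -- `B`.
  ReachIn : Pred (Fin n) 0ℓ → Fin n → Fin n → Set
  ReachIn P u v = Σ[ w ∈ Walk G u v ] All P (vertices G w)

  module _ {P : Pred (Fin n) 0ℓ} where

    source∈ : ∀ {u v} → ReachIn P u v → P u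
    source∈ (ε     , p ∷ _) = p
    source∈ (_ ◅ _ , p ∷ _) = p

    reachIn-◅ : ∀ {u v w} → P u → Adj u v → ReachIn P v w → ReachIn P u w
    reachIn-◅ p e (w , ps) = e ◅ w , p ∷ ps

    reachIn-trans : ∀ {u v w} → ReachIn P u v → ReachIn P v w → ReachIn P u w
    reachIn-trans (ε     , _)      r = r
    reachIn-trans (e ◅ w , p ∷ ps) r = reachIn-◅ p e (reachIn-trans (w , ps) r)

    reachIn-sym : ∀ {u v} → ReachIn P u v → ReachIn P v u
    reachIn-sym (ε     , ps)     = ε , ps
    reachIn-sym (e ◅ w , p ∷ ps) =
      reachIn-trans (reachIn-sym (w , ps))
        (reachIn-◅ (source∈ (w , ps)) (Adj-sym e) (ε , p ∷ []))

    prefix : ∀ {u v z} (w : Walk G u v) → All P (vertices G w) → z List.∈ vertices G w →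
      ReachIn P u z
    prefix ε       (p ∷ _)  (here refl) = ε , p ∷ []
    prefix (e ◅ w) (p ∷ _)  (here refl) = ε , p ∷ []
    prefix (e ◅ w) (p ∷ ps) (there z∈)  = reachIn-◅ p e (prefix w ps z∈)

  proper-prefix : ∀ {u v z} (w : Walk G u v) → z List.∈ vertices G w → z ≢ v →
    Σ[ w′ ∈ Walk G u z ] edges G w′ < edges G w
  proper-prefix ε       (here refl) z≢v = contradiction refl z≢v
  proper-prefix (e ◅ w) (here refl) z≢v = ε , s≤s z≤n
  proper-prefix (e ◅ w) (there z∈)  z≢v with proper-prefix w z∈ z≢v
  ... | w′ , w′<w = e ◅ w′ , s≤s w′<w

  length-vertices : ∀ {u v} (w : Walk G u v) → length (vertices G w) ≡ suc (edges G w)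
  length-vertices ε       = refl
  length-vertices (e ◅ w) = cong suc (length-vertices w)

  suffixPath : ∀ {P : Pred (Fin n) 0ℓ} {u v z} (w : Walk G u v) → Unique (vertices G w) →
    All P (vertices G w) → z List.∈ vertices G w →
    Σ[ Q ∈ Path G z v ] edges G (proj₁ Q) ≤ edges G w × All P (vertices G (proj₁ Q))
  suffixPath ε       u       ps       (here refl) = (ε , u) , z≤n , ps
  suffixPath (e ◅ w) u       ps       (here refl) = (e ◅ w , u) , ℕ.≤-refl , ps
  suffixPath (e ◅ w) (_ ∷ u) (_ ∷ ps) (there z∈) with suffixPath w u ps z∈
  ... | Q , Q≤w , qs = Q , ℕ.m≤n⇒m≤1+n Q≤w , qs

  -- If `u` recurs on the path made from the tail, the closed part is dropped by restarting at that
  -- occurrence. No new vertices appear, so avoidance is preserved.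
  toPath : ∀ {P : Pred (Fin n) 0ℓ} {u v} (w : Walk G u v) → All P (vertices G w) →
    Σ[ Q ∈ Path G u v ] edges G (proj₁ Q) ≤ edges G w × All P (vertices G (proj₁ Q))
  toPath ε ps = (ε , [] ∷ []) , z≤n , ps
  toPath {u = u} (e ◅ w) (p ∷ ps) with toPath w ps
  ... | (q , uq) , q≤w , qs with u ∈ᴸ? vertices G q
  ...   | no  u∉q = (e ◅ q , ¬Any⇒All¬ _ u∉q ∷ uq) , s≤s q≤w , p ∷ qs
  ...   | yes u∈q with suffixPath q uq qs u∈q
  ...     | Q , Q≤q , qs′ = Q , ℕ.m≤n⇒m≤1+n (ℕ.≤-trans Q≤q q≤w) , qs′

  shorten : ∀ {u v} (w : Walk G u v) → Σ[ Q ∈ Path G u v ] edges G (proj₁ Q) ≤ edges G w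
  -- No restriction is wanted: the constant predicate `Fin n` holds everywhere, each vertex being
  -- its own witness.
  shorten w with toPath {P = λ _ → Fin n} w (All.universal id _)
  ... | Q , Q≤w , _ = Q , Q≤w

  path-edges< : ∀ {u v} (Q : Path G u v) → edges G (proj₁ Q) < n
  path-edges< (w , u) = subst (_≤ n) (length-vertices w)
    (ℕ.≤-trans (length-unique≤ ⊤ u (All.universal (λ _ → ∈⊤) _)) (∣p∣≤n ⊤))

  geodesic-exists : ∀ {u v} → Walk G u v → ¬ ¬ (Σ[ Q ∈ Path G u v ] IsGeodesic G Q)
  geodesic-exists {u} {v} w ¬∃ = <-rec (λ k → (Q : Path G u v) → ¬ (edges G (proj₁ Q) ≡ k))
    (λ { _ rec Q refl → ¬∃ (Q , λ R → ℕ.≮⇒≥ λ R<Q → rec R<Q R refl) })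
    _ (proj₁ (shorten w)) refl

  -- Cycles and blocks

  module _ {P : Pred (Fin n) 0ℓ} {r : Fin n} where

    -- Deleting `r` splits a path into at most two pieces, each still holding an endpoint of the
    -- path.
    reach-endpoint : ∀ {u v z} (w : Walk G u v) → Unique (vertices G w) →
      (∀ {y} → y List.∈ vertices G w → r ≢ y → P y) →
      z List.∈ vertices G w → r ≢ z → ReachIn P z u ⊎ ReachIn P z v
    reach-endpoint ε       _ inP (here refl) r≢z = inj₁ (ε , inP (here refl) r≢z ∷ [])
    reach-endpoint (e ◅ w) _ inP (here refl) r≢z = inj₁ (ε , inP (here refl) r≢z ∷ [])
    reach-endpoint {u = u} (e ◅ w) (u∉w ∷ uw) inP (there z∈) r≢z
      with reach-endpoint w uw (inP ∘ there) z∈ r≢z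
    ... | inj₂ z⇝v = inj₂ z⇝v
    ... | inj₁ z⇝u′ with r ≟ u
    ...   | no  r≢u  = inj₁ (reachIn-trans z⇝u′
                         (reachIn-◅ (source∈ (reachIn-sym z⇝u′)) (Adj-sym e)
                           (ε , inP (here refl) r≢u ∷ [])))
    -- Here `r` is the first vertex; by uniqueness the tail avoids it and leads on to `v`.
    ...   | yes refl = inj₂ (reachIn-trans z⇝u′
                         (w , All.tabulate λ y∈ → inP (there y∈) (All.lookup u∉w y∈)))

  -- After a deletion every remaining vertex still reaches `u` or `v`, and the closing edge joins
  -- the two if both are needed.
  cycle-twoConnected : ∀ {u v} ((w , _) : Path G u v) → Adj v u → 3 ≤ length (vertices G w) →
    TwoConnected G (toSubset (_∈ᴸ? vertices G w))
  cycle-twoConnected {u} {v} (w , uw) v~u 3≤ =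
    ℕ.≤-trans 3≤ (length-unique≤ B uw w⊆B) , connected , connected-minus
    where
    B : Subset n
    B = toSubset (_∈ᴸ? vertices G w)

    w⊆B : All (_∈ B) (vertices G w)
    w⊆B = All.tabulate (∈-toSubset⁺ (_∈ᴸ? vertices G w))

    from-B : ∀ {y} → y ∈ B → y List.∈ vertices G w
    from-B = ∈-toSubset⁻ (_∈ᴸ? vertices G w)

    connected : ConnectedOn G B
    connected a∈ b∈ = reachIn-trans (reachIn-sym (prefix w w⊆B (from-B a∈)))
                                    (prefix w w⊆B (from-B b∈))

    connected-minus : ∀ {r} → r ∈ B → ConnectedOn G (B - r)
    connected-minus {r} _ {a} {b} a∈ b∈ = join (endpoint a∈) (endpoint b∈)
      where
      P : Pred (Fin n) 0ℓ
      P = _∈ (B - r)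

      endpoint : ∀ {y} → y ∈ B - r → ReachIn P y u ⊎ ReachIn P y v
      endpoint y∈ = reach-endpoint w uw
        (λ y∈w r≢y → x∈p∧x≢y⇒x∈p-y (All.lookup w⊆B y∈w) (≢-sym r≢y))
        (from-B (p─q⊆p B _ y∈)) (λ { refl → x∉p-x B r y∈ })

      via : ∀ {c d e f} → ReachIn P c d → Adj d e → ReachIn P f e → ReachIn P c f
      via c⇝d d~e f⇝e = reachIn-trans c⇝d
        (reachIn-◅ (source∈ (reachIn-sym c⇝d)) d~e (reachIn-sym f⇝e))

      join : ReachIn P a u ⊎ ReachIn P a v → ReachIn P b u ⊎ ReachIn P b v → ReachIn P a b
      join (inj₁ a⇝u) (inj₁ b⇝u) = reachIn-trans a⇝u (reachIn-sym b⇝u)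
      join (inj₁ a⇝u) (inj₂ b⇝v) = via a⇝u (Adj-sym v~u) b⇝v
      join (inj₂ a⇝v) (inj₁ b⇝u) = via a⇝v v~u b⇝u
      join (inj₂ a⇝v) (inj₂ b⇝v) = reachIn-trans a⇝v (reachIn-sym b⇝v)

  -- If no block contains `B`, then `B` is itself maximal, since a proper 2-connected superset would
  -- lie in a block by induction.
  extend-to-block : ∀ {B} → Acc _⊃_ B → TwoConnected G B →
    ¬ ¬ (∃[ C ] MaximalTwoConnected G C × B ⊆ C)
  extend-to-block {B} (acc rec) B-2c ¬∃ = ¬∃ (B , (B-2c , maximal) , id)
    where
    maximal : ∀ {C} → TwoConnected G C → B ⊆ C → C ⊆ B
    maximal {C} C-2c B⊆C {y} y∈C = decidable-stable (y ∈? B) λ y∉B →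
      extend-to-block (rec (B⊆C , y , y∈C , y∉B)) C-2c
        λ (D , D-max , C⊆D) → ¬∃ (D , D-max , C⊆D ∘ B⊆C)

  neighbours-joined-adjacent : IsBlockGraph G → ∀ {y p q} → Adj y p → Adj y q → p ≢ q →
    ReachIn (y ≢_) p q → Adj p q
  neighbours-joined-adjacent block {y} {p} {q} y~p y~q p≢q (w , y∉w) with toPath w y∉w
  ... | (w′ , uw′) , _ , y∉w′ = decidable-stable (adj? p q) λ p≁q →
    extend-to-block (⊃-wellFounded _)
      -- The cycle runs from `y` along the path to `q` and back; `p ≢ q` gives the path two
      -- vertices, and `y` is the third.
      (cycle-twoConnected (y~p ◅ w′ , y∉w′ ∷ uw′) (Adj-sym y~q) (s≤s (2≤vertices w′)))
      λ (C , C-max , ⊆C) → p≁q (block C-max p q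
        (⊆C (∈B (there (start w′)))) (⊆C (∈B (there (end w′)))) p≢q)
    where
    2≤vertices : (w : Walk G p q) → 2 ≤ length (vertices G w)
    2≤vertices ε       = contradiction refl p≢q
    2≤vertices (_ ◅ w) = s≤s (subst (1 ≤_) (sym (length-vertices w)) (s≤s z≤n))

    start : ∀ {u v} (w : Walk G u v) → u List.∈ vertices G w
    start ε       = here refl
    start (_ ◅ _) = here refl

    end : ∀ {u v} (w : Walk G u v) → v List.∈ vertices G w
    end ε       = here refl
    end (_ ◅ w) = there (end w)

    ∈B : ∀ {z} → z List.∈ vertices G (y~p ◅ w′) → z ∈ toSubset (_∈ᴸ? vertices G (y~p ◅ w′))
    ∈B = ∈-toSubset⁺ (_∈ᴸ? vertices G (y~p ◅ w′))

  -- Simplicial vertices on walks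

  -- The vertices before and after `y` on the walk are both neighbours of `y`, hence equal or
  -- adjacent.
  bypass-simplicial : ∀ {y} → Simplicial G y → ∀ {u v} (w : Walk G u v) → y List.∈ vertices G w →
    y ≢ u → y ≢ v → Σ[ w′ ∈ Walk G u v ] edges G w′ < edges G w
  bypass-simplicial simp ε       (here refl) y≢u y≢v = contradiction refl y≢u
  bypass-simplicial simp (e ◅ w) (here refl) y≢u y≢v = contradiction refl y≢u
  bypass-simplicial {y} simp {u} (_◅_ {j = b} e w) (there y∈) y≢u y≢v with y ≟ b
  ... | no y≢b with bypass-simplicial simp w y∈ y≢b y≢v
  ...   | w′ , w′<w = e ◅ w′ , s≤s w′<w
  bypass-simplicial simp (e ◅ ε) (there y∈) y≢u y≢v | yes refl = contradiction refl y≢v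
  bypass-simplicial simp {u} (e ◅ _◅_ {j = c} f w) (there y∈) y≢u y≢v | yes refl with u ≟ c
  -- The walk steps to `y` and straight back, so both edges go; otherwise one chord replaces them.
  ... | yes refl = w , ℕ.m≤n⇒m≤1+n ℕ.≤-refl
  ... | no  u≢c  = simp u c (Adj-sym e) f u≢c ◅ w , ℕ.≤-refl

  simplicial⇒positionSet : ∀ {x S} → (∀ {y} → y ∈ S → Simplicial G y) → x ∉ S →
    IsPositionSet G x S
  simplicial⇒positionSet simp x∉S y∈S z∈S z≢y P geo z∈P
    with bypass-simplicial (simp z∈S) (proj₁ P) z∈P (λ { refl → x∉S z∈S }) z≢y
  ... | w , w<P with shorten w
  ...   | Q , Q≤w = ℕ.<⇒≱ (ℕ.≤-<-trans Q≤w w<P) (geo Q)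

  -- Domination

  module _ (x : Fin n) where

    -- The dominator relation of the graph rooted at `x`; in particular `x` dominates every vertex.
    Dominates : Fin n → Fin n → Set
    Dominates y w = ¬ ReachIn (y ≢_) x w

    meets : ∀ {y w} → Dominates y w → (W : Walk G x w) → y List.∈ vertices G W
    meets {y} dom W = decidable-stable (y ∈ᴸ? vertices G W) λ y∉W → dom (W , ¬Any⇒All¬ _ y∉W)

    dominates-refl : ∀ {y} → Dominates y y
    dominates-refl r = source∈ (reachIn-sym r) refl

    -- A walk to `c` avoiding `a` would meet `b`, and its part up to `b` would avoid `a`.
    dominates-trans : ∀ {a b c} → Dominates a b → Dominates b c → Dominates a c
    dominates-trans a-b b-c (w , a∉w) = a-b (prefix w a∉w (meets b-c w))

    -- The equation exposes the tail `xs` of the vertex list, so that the trivial walk and the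
    -- extended walk share one argument.
    last-visit-cons : ∀ {a b} → a ≢ b → ∀ {u v} (w : Walk G u v) {xs : List (Fin n)} →
      vertices G w ≡ u ∷ xs → All (a ≢_) xs → All (b ≢_) xs →
      All (a ≢_) (vertices G w) × All (b ≢_) (vertices G w) ⊎
      ReachIn (b ≢_) a v ⊎ ReachIn (a ≢_) b v
    last-visit-cons {a} {b} a≢b {u} w eq a∉ b∉ with a ≟ u | b ≟ u
    ... | yes refl | _        = inj₂ (inj₁ (w , subst (All (b ≢_)) (sym eq) (≢-sym a≢b ∷ b∉)))
    ... | no _     | yes refl = inj₂ (inj₂ (w , subst (All (a ≢_)) (sym eq) (a≢b ∷ a∉)))
    ... | no a≢u   | no b≢u   = inj₁ (subst (All (a ≢_)) (sym eq) (a≢u ∷ a∉)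
                                    , subst (All (b ≢_)) (sym eq) (b≢u ∷ b∉))

    last-visit : ∀ {a b} → a ≢ b → ∀ {u v} (w : Walk G u v) →
      All (a ≢_) (vertices G w) × All (b ≢_) (vertices G w) ⊎
      ReachIn (b ≢_) a v ⊎ ReachIn (a ≢_) b v
    last-visit a≢b ε       = last-visit-cons a≢b ε refl [] []
    last-visit a≢b (e ◅ w) with last-visit a≢b w
    ... | inj₁ (a∉ , b∉) = last-visit-cons a≢b (e ◅ w) refl a∉ b∉
    ... | inj₂ r         = inj₂ r

    module _ (connected : Connected G) where

      -- Otherwise `x` reaches each of `a`, `b` avoiding the other. Continuing from the last visit
      -- to either on a walk to `w` yields a walk that avoids one of the two dominators.
      dominators-comparable : ∀ {a b w} → a ≢ b → Dominates a w → Dominates b w →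
        ¬ Dominates a b → ¬ ¬ Dominates b a
      dominators-comparable {a} {b} {w} a≢b a-w b-w ¬a-b ¬b-a =
        ¬a-b λ x⇝b → ¬b-a λ x⇝a → contra x⇝b x⇝a (last-visit a≢b W)
        where
        W = connected x w

        contra : ReachIn (a ≢_) x b → ReachIn (b ≢_) x a →
          ¬ (All (a ≢_) (vertices G W) × All (b ≢_) (vertices G W) ⊎
             ReachIn (b ≢_) a w ⊎ ReachIn (a ≢_) b w)
        contra x⇝b x⇝a (inj₁ (a∉W , _))   = a-w (W , a∉W)
        contra x⇝b x⇝a (inj₂ (inj₁ a⇝w)) = b-w (reachIn-trans x⇝a a⇝w)
        contra x⇝b x⇝a (inj₂ (inj₂ b⇝w)) = a-w (reachIn-trans x⇝b b⇝w)

      positionSet⇒¬dominates : ∀ {S y z} → IsPositionSet G x S → y ∈ S → z ∈ S → z ≢ y →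
        ¬ Dominates z y
      positionSet⇒¬dominates {y = y} pos y∈ z∈ z≢y z-y =
        geodesic-exists (connected x y) λ (P , geo) → pos y∈ z∈ z≢y P geo (meets z-y (proj₁ P))

      module _ (block : IsBlockGraph G) where

        undominating⇒simplicial : ∀ {y} → (∀ {w} → y ≢ w → ¬ Dominates y w) → Simplicial G y
        undominating⇒simplicial {y} undom a b y~a y~b a≢b = decidable-stable (adj? a b) λ a≁b →
          undom (≢neighbour y~a) λ x⇝a → undom (≢neighbour y~b) λ x⇝b →
            a≁b (neighbours-joined-adjacent block y~a y~b a≢b
              (reachIn-trans (reachIn-sym x⇝a) x⇝b))
          where
          ≢neighbour : ∀ {c} → Adj y c → y ≢ c
          ≢neighbour y~c refl = irrefl y~c

        -- A strict domination step raises the lower bound k on the distance from x,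
        -- which stays below n.
        climb : ∀ fuel k → k + fuel ≡ n → ∀ {y} → x ≢ y → ((w : Walk G x y) → k ≤ edges G w) →
          ¬ ¬ (∃[ ℓ ] x ≢ ℓ × Simplicial G ℓ × Dominates y ℓ)
        climb zero k k+0≡n {y} x≢y far ¬∃ with shorten (connected x y)
        ... | Q , _ = ℕ.<⇒≱ (path-edges< Q)
          (subst (_≤ edges G (proj₁ Q)) (trans (sym (ℕ.+-identityʳ k)) k+0≡n) (far (proj₁ Q)))
        climb (suc fuel) k k+f≡n {y} x≢y far ¬∃ =
          ¬∃ (y , x≢y , undominating⇒simplicial undom , dominates-refl)
          where
          undom : ∀ {w} → y ≢ w → ¬ Dominates y w
          undom {w} y≢w y-w = climb fuel (suc k) (trans (sym (ℕ.+-suc k fuel)) k+f≡n) x≢w far′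
            λ (ℓ , x≢ℓ , simp , w-ℓ) → ¬∃ (ℓ , x≢ℓ , simp , dominates-trans y-w w-ℓ)
            where
            x≢w : x ≢ w
            -- The trivial walk at `x` avoids `y`, so `y` cannot dominate `x`.
            x≢w refl = y-w (ε , ≢-sym x≢y ∷ [])

            far′ : (W : Walk G x w) → suc k ≤ edges G W
            far′ W with proper-prefix W (meets y-w W) y≢w
            ... | W′ , W′<W = ℕ.≤-<-trans (far W′) W′<W

        dominates-simplicial : 2 ≤ n → ∀ y → ¬ ¬ (∃[ ℓ ] x ≢ ℓ × Simplicial G ℓ × Dominates y ℓ)
        dominates-simplicial 2≤n y ¬∃ with x ≟ y
        ... | no x≢y = climb n 0 refl x≢y (λ _ → z≤n) ¬∃
        -- Since `x` dominates everything, a simplicial vertex found from any other starting vertex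
        -- serves.
        ... | yes refl with other-vertex 2≤n x
        ...   | w , x≢w = climb n 0 refl x≢w (λ _ → z≤n)
          λ (ℓ , x≢ℓ , simp , _) → ¬∃ (ℓ , x≢ℓ , simp , λ r → source∈ r refl)

        positionSet-bound : 2 ≤ n → ∀ {S} → IsPositionSet G x S →
          ∣ S ∣ ≤ ∣ toSubset (simplicial? G) - x ∣
        positionSet-bound 2≤n {S} pos = ∣∣-mono-injective S _ Dominates
          (λ {y} _ ¬∃ → dominates-simplicial 2≤n y λ (ℓ , x≢ℓ , simp , y-ℓ) →
            ¬∃ (ℓ , x∈p∧x≢y⇒x∈p-y (∈-toSubset⁺ (simplicial? G) simp) (≢-sym x≢ℓ) , y-ℓ))
          -- Two distinct members dominating the same `ℓ` would be comparable, which a position set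
          -- forbids.
          λ {y} {z} y∈ z∈ y-ℓ z-ℓ → decidable-stable (y ≟ z) λ y≢z →
            dominators-comparable y≢z y-ℓ z-ℓ
              (positionSet⇒¬dominates pos z∈ y∈ y≢z)
              (positionSet⇒¬dominates pos y∈ z∈ (≢-sym y≢z))

-- The bound `2 ≤ n` excludes the one-vertex graph, whose position number is 1 rather than 0.
theorem3p5 : ∀ {n : ℕ} (G : Graph n) → 2 ≤ n → Connected G → IsBlockGraph G → (x : Fin n) →
    (Simplicial G x → IsPositionNumber G x (s G ∸ 1)) × (¬ Simplicial G x → IsPositionNumber G x (s G))
theorem3p5 G 2≤n connected block x = simplicial-case , non-simplicial-case
  where
  T = toSubset (simplicial? G)

  ∣T∣≡s : ∣ T ∣ ≡ s G
  ∣T∣≡s = ∣toSubset∣ (simplicial? G) id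

  bound : ∀ {S} → IsPositionSet G x S → ∣ S ∣ ≤ ∣ T - x ∣
  bound = positionSet-bound G x connected block 2≤n

  simplicial-case : Simplicial G x → IsPositionNumber G x (s G ∸ 1)
  simplicial-case simp =
    (T - x , simplicial⇒positionSet G (∈-toSubset⁻ (simplicial? G) ∘ p─q⊆p T _) (x∉p-x T x) ,
     ∣T-x∣≡) ,
    λ pos → subst (_ ≤_) ∣T-x∣≡ (bound pos)
    where
    ∣T-x∣≡ : ∣ T - x ∣ ≡ s G ∸ 1
    ∣T-x∣≡ = trans (x∈p⇒∣p-x∣≡∣p∣∸1 (∈-toSubset⁺ (simplicial? G) simp)) (cong (_∸ 1) ∣T∣≡s)

  non-simplicial-case : ¬ Simplicial G x → IsPositionNumber G x (s G)
  non-simplicial-case ¬simp =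
    (T , simplicial⇒positionSet G (∈-toSubset⁻ (simplicial? G)) (¬simp ∘ ∈-toSubset⁻ (simplicial? G)) ,
     ∣T∣≡s) ,
    -- Here `x` is not in `T`, so passing from `T - x` to `T` loses nothing.
    λ pos → subst (_ ≤_) ∣T∣≡s (ℕ.≤-trans (bound pos) (∣p─q∣≤∣p∣ T _))
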